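{- Let $(\mathcal{R},\oplus,\leqslant)$ be a lattice ordered monoid with neutral element $0$ whose lattice is conditionally complete, let $D=(V,A)$ be a finite digraph with $o,d\in V$, let $(x_a)_{a\in A}\in\mathcal{R}^A$, let $c:\mathcal{R}\to\mathbb{R}$ and $\rho:\mathcal{R}\to\{0,1\}$ be isotone, and for each $v\in V$ let $b_v\in\mathcal{R}$ satisfy $b_v\leqslant x_P$ for every $v$-$d$ path $P$. Consider the two assumptions: (W) for all $a,b<\bigvee\mathcal{R}$ and all $x>0$ in $\mathcal{R}$, there exists $n\in\mathbb{Z}_+$ such that $nx\oplus a\not\leqslant b$, where $nx=x\oplus\cdots\oplus x$ ($n$ times); (B) there exists a feasible $o$-$d$ path $P$ such that $c^{ -1}\big((-\infty,c(x_P)]\big)\cap\rho^{ -1}(0)$ is upper-bounded by a resource $x_M<\bigvee\mathcal{R}$. Suppose that at least one of the following conditions is satisfied: (a) $D$ is acyclic; (b) (W) and (B) are satisfied, $x_a>0$ for each arc $a$, and $b_v\geqslant 0$ for each vertex $v$; (c) (W) and (B) are satisfied, $\oplus$ is commutative, and $\bigoplus_{a\in C}x_a>0$ for every cycle $C$ in $D$. Then the generalized A$^*$ algorithm (run with the bounds $b_v$) terminates after a finite number of iterations, and at the end, if $c_{od}^{UB}$ is finite, then it is the cost of an optimal solution of the Monoid Resource Constrained Shortest Path Problem; otherwise, the problem admits no feasible solution.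
   Context: A lattice ordered monoid $(\mathcal{R},\oplus,\leqslant)$ is a monoid $(\mathcal{R},\oplus)$ (associative, with neutral element $0$, possibly non-commutative) with a partial order $\leqslant$ that is a lattice order and is such that all translations $y\mapsto x\oplus y$ and $y\mapsto y\oplus x$ are isotone (order-preserving). Conditionally complete: every nonempty bounded subset has a meet and a join. $\bigvee\mathcal{R}$ is the least upper bound of $\mathcal{R}$; if it does not exist in $\mathcal{R}$ it is the element $+\infty$ of the completion $\mathcal{R}\cup\{ -\infty,+\infty\}$, which is greater than every element of $\mathcal{R}$. Paths are finite sequences of arcs, the head of each being the tail of the next; vertices and arcs may be repeated, and empty paths (one at each vertex, with resource $0$) are allowed. A cycle is a nonempty path whose origin equals its destination. The resource of a path $P=(a_1,\dots,a_k)$ is $x_P=x_{a_1}\oplus\cdots\oplus x_{a_k}$. $P$ is feasible if $\rho(x_P)=0$; its cost is $c(x_P)$. The Monoid Resource Constrained Shortest Path Problem asks for a feasible $o$-$d$ path of minimum cost; an optimal solution is such a path. Generalized A$^*$ algorithm: maintain a list $L$ of paths with origin $o$ and a value $c_{od}^{UB}\in\mathbb{R}\cup\{+\infty\}$. Initially $L$ contains only the empty path at $o$ and $c_{od}^{UB}=+\infty$. While $L$ is nonempty, repeat: (1) extract (remove) from $L$ a path $P$, with destination denoted $v$, of minimum key $c(x_P\oplus b_v)$ among the paths of $L$ (ties broken arbitrarily); (2) if $v=d$, $\rho(x_P)=0$ and $c(x_P)<c_{od}^{UB}$, then set $c_{od}^{UB}:=c(x_P)$; (3) else, if the lower bound test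 "$\rho(x_P\oplus b_v)=0$ and $c(x_P\oplus b_v)\leq c_{od}^{UB}$" holds, extend $P$: for each arc $a$ outgoing from $v$, add $P+a$ ($P$ followed by $a$) to $L$. -}

module Defs where

open import Level using (Level; Setω; _⊔_; 0ℓ) renaming (suc to lsuc)
open import Algebra.Bundles using (Monoid)
open import Algebra.Core using (Op₂)
import Algebra.Definitions as AlgebraDefinitions
import Algebra.Definitions.RawMonoid as RawMonoidDefinitions
open import Algebra.Structures using (IsMonoid)
open import Data.Fin.Base as Fin using (Fin)
open import Data.Fin.Patterns using (0F)
import Data.Fin.Properties as Fin
open import Data.List.Base using (List; []; _∷_; _++_; map; mapMaybe; allFin)
open import Data.List.Membership.Propositional using (_∈_)
open import Data.List.Relation.Unary.Any using (_─_)
import Data.Maybe.Base as Maybe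
open import Data.Nat.Base using (ℕ)
open import Data.Product using (Σ; ∃; _×_; _,_; proj₁; proj₂)
open import Data.Rational.Base as ℚ using (ℚ)
open import Data.Sum.Base using (_⊎_)
open import Function.Bundles using (_⇔_)
import Relation.Binary.Construct.Add.Supremum.NonStrict as Supremum≤
import Relation.Binary.Construct.Add.Supremum.Strict as Supremum<
open import Relation.Binary.Construct.Closure.ReflexiveTransitive
  using (Star; ε; _◅_; _◅◅_)
import Relation.Binary.Construct.NonStrictToStrict as ToStrict
open import Relation.Binary.Core using (Rel; _Preserves_⟶_)
open import Relation.Binary.Lattice.Structures using (IsLattice)
open import Relation.Binary.PropositionalEquality.Core using (_≡_; _≢_; refl)
open import Relation.Nullary using (¬_)
open import Relation.Nullary.Construct.Add.Supremum using (_⁺; [_]; ⊤⁺)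
open import Relation.Nullary.Decidable.Core using (dec⇒maybe)
open import Relation.Unary using (Pred; U; _⊆_)

-- Two-sided Dedekind cuts. Costs are only ever compared, so no arithmetic is
-- needed.

record ℝ : Set₁ where
  field
    Lower Upper      : Pred ℚ 0ℓ
    lower-inhabited  : ∃ Lower
    upper-inhabited  : ∃ Upper
    lower-rounded    : ∀ q → Lower q ⇔ ∃ λ r → q ℚ.< r × Lower r
    upper-rounded    : ∀ q → Upper q ⇔ ∃ λ r → r ℚ.< q × Upper r
    disjoint         : ∀ q → ¬ (Lower q × Upper q)
    located          : ∀ {q r} → q ℚ.< r → Lower q ⊎ Upper r

infix 4 _≤ᴿ_ _<ᴿ_ _≈ᴿ_

_≤ᴿ_ _<ᴿ_ _≈ᴿ_ : Rel ℝ 0ℓ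
x ≤ᴿ y = ℝ.Lower x ⊆ ℝ.Lower y
x <ᴿ y = ∃ λ q → ℝ.Upper x q × ℝ.Lower y q
x ≈ᴿ y = x ≤ᴿ y × y ≤ᴿ x

open Supremum≤ _≤ᴿ_ public using () renaming (_≤⁺_ to _≤ᴿ⁺_)
open Supremum< _<ᴿ_ public using () renaming (_<⁺_ to _<ᴿ⁺_)

record LatticeOrderedMonoid (c ℓ₁ ℓ₂ : Level) : Set (lsuc (c ⊔ ℓ₁ ⊔ ℓ₂)) where
  infix  4 _≈_ _≤_ _<_ _<⋁
  infixr 7 _⊕_
  field
    Carrier   : Set c
    _≈_       : Rel Carrier ℓ₁
    _≤_       : Rel Carrier ℓ₂
    _∨_ _∧_   : Op₂ Carrier
    _⊕_       : Op₂ Carrier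
    𝟎         : Carrier
    isLattice : IsLattice _≈_ _≤_ _∨_ _∧_
    isMonoid  : IsMonoid _≈_ _⊕_ 𝟎
    ⊕-isotoneʳ : ∀ x → (λ y → x ⊕ y) Preserves _≤_ ⟶ _≤_
    ⊕-isotoneˡ : ∀ x → (λ y → y ⊕ x) Preserves _≤_ ⟶ _≤_

  monoid : Monoid c ℓ₁
  monoid = record { isMonoid = isMonoid }

  _<_ : Rel Carrier (ℓ₁ ⊔ ℓ₂)
  _<_ = ToStrict._<_ _≈_ _≤_

  open RawMonoidDefinitions (Monoid.rawMonoid monoid) public
    using () renaming (_×_ to _·_)

  IsUpperBound IsLowerBound IsJoin IsMeet :
    ∀ {s} → Pred Carrier s → Pred Carrier (c ⊔ ℓ₂ ⊔ s)
  IsUpperBound S u = ∀ {y} → S y → y ≤ u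
  IsLowerBound S l = ∀ {y} → S y → l ≤ y
  IsJoin S z = IsUpperBound S z × (∀ {u} → IsUpperBound S u → z ≤ u)
  IsMeet S z = IsLowerBound S z × (∀ {l} → IsLowerBound S l → l ≤ z)

  ConditionallyComplete : Setω
  ConditionallyComplete = ∀ {s} (S : Pred Carrier s) →
    ∃ S → ∃ (IsUpperBound S) → ∃ (IsLowerBound S) → ∃ (IsJoin S) × ∃ (IsMeet S)

  -- `Is⋁ s` says that s is the join of the whole carrier: its least upper
  -- bound if there is one, and the added element +∞ (here ⊤⁺) otherwise.
  Is⋁ : Pred (Carrier ⁺) (c ⊔ ℓ₂)
  Is⋁ [ t ] = IsJoin U t
  Is⋁ ⊤⁺    = ¬ ∃ (IsJoin U)

  open Supremum< _<_ public using () renaming (_<⁺_ to _<ᶜ_)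

  _<⋁ : Pred Carrier (c ⊔ ℓ₁ ⊔ ℓ₂)
  z <⋁ = ∃ λ s → Is⋁ s × [ z ] <ᶜ s

  Commutative : Set (c ⊔ ℓ₁)
  Commutative = AlgebraDefinitions.Commutative _≈_ _⊕_

  AssumptionW : Set (c ⊔ ℓ₁ ⊔ ℓ₂)
  AssumptionW = ∀ {a b x} → a <⋁ → b <⋁ → 𝟎 < x →
    ∃ λ n → ¬ ((n · x) ⊕ a ≤ b)

-- Loops and parallel arcs are allowed.

record Digraph : Set where
  field
    ∣V∣ ∣A∣   : ℕ
    tail head : Fin ∣A∣ → Fin ∣V∣

  Vertex Arc : Set
  Vertex = Fin ∣V∣
  Arc    = Fin ∣A∣

  ArcBetween : Rel Vertex 0ℓ
  ArcBetween u v = ∃ λ a → tail a ≡ u × head a ≡ v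

  Path : Rel Vertex 0ℓ
  Path = Star ArcBetween

  Cycle : Set
  Cycle = ∃ λ v → Σ (Path v v) (_≢ ε)

  Acyclic : Set
  Acyclic = ¬ Cycle

  PathFrom : Vertex → Set
  PathFrom o = ∃ λ v → Path o v

  outgoing : ∀ v → List (∃ λ w → ArcBetween v w)
  outgoing v = mapMaybe
    (λ a → Maybe.map (λ tail≡v → head a , a , tail≡v , refl)
                     (dec⇒maybe (tail a Fin.≟ v)))
    (allFin ∣A∣)

  extensions : ∀ {o} → PathFrom o → List (PathFrom o)
  extensions (v , P) = map (λ (w , a) → w , P ◅◅ (a ◅ ε)) (outgoing v)

record Problem {c ℓ₁ ℓ₂} (M : LatticeOrderedMonoid c ℓ₁ ℓ₂)
               : Set (lsuc 0ℓ ⊔ c ⊔ ℓ₁ ⊔ ℓ₂) where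
  open LatticeOrderedMonoid M
  field
    digraph : Digraph
  open Digraph digraph public
  field
    o d            : Vertex
    x              : Arc → Carrier
    cost           : Carrier → ℝ
    cost-isotone   : cost Preserves _≤_ ⟶ _≤ᴿ_
    ρ              : Carrier → Fin 2
    ρ-isotone      : ρ Preserves _≤_ ⟶ Fin._≤_

  resource : ∀ {u v} → Path u v → Carrier
  resource ε             = 𝟎
  resource ((a , _) ◅ P) = x a ⊕ resource P

  Feasible Optimal : Pred (Path o d) 0ℓ
  Feasible P = ρ (resource P) ≡ 0F
  Optimal  P = Feasible P ×
    (∀ Q → Feasible Q → cost (resource P) ≤ᴿ cost (resource Q))

  AssumptionB : Set (c ⊔ ℓ₁ ⊔ ℓ₂)
  AssumptionB = ∃ λ P → Feasible P × ∃ λ x_M → x_M <⋁ ×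
    IsUpperBound (λ y → cost y ≤ᴿ cost (resource P) × ρ y ≡ 0F) x_M

  PositiveCycles : Set (ℓ₁ ⊔ ℓ₂)
  PositiveCycles = (C : Cycle) → 𝟎 < resource (proj₁ (proj₂ C))

  LowerBounds : (Vertex → Carrier) → Set ℓ₂
  LowerBounds b = ∀ {v} (P : Path v d) → b v ≤ resource P

module GeneralizedA* {c ℓ₁ ℓ₂} {M : LatticeOrderedMonoid c ℓ₁ ℓ₂}
  (I : Problem M) (b : Problem.Vertex I → LatticeOrderedMonoid.Carrier M) where

  open LatticeOrderedMonoid M
  open Problem I

  record State : Set₁ where
    constructor ⟨_,_⟩
    field
      L  : List (PathFrom o)
      UB : ℝ ⁺

  initial : State
  initial = ⟨ (o , ε) ∷ [] , ⊤⁺ ⟩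

  key : PathFrom o → ℝ
  key (v , P) = cost (resource P ⊕ b v)

  MinimalKey : List (PathFrom o) → Pred (PathFrom o) 0ℓ
  MinimalKey L P = ∀ {Q} → Q ∈ L → key P ≤ᴿ key Q

  Improves : ℝ ⁺ → Pred (PathFrom o) (lsuc 0ℓ)
  Improves UB (v , P) =
    v ≡ d × ρ (resource P) ≡ 0F × [ cost (resource P) ] <ᴿ⁺ UB

  LowerBoundTest : ℝ ⁺ → Pred (PathFrom o) (lsuc 0ℓ)
  LowerBoundTest UB (v , P) =
    ρ (resource P ⊕ b v) ≡ 0F × [ cost (resource P ⊕ b v) ] ≤ᴿ⁺ UB

  -- One iteration of the loop. Any path of minimum key may be chosen, so the
  -- relation covers every way of breaking ties.

  infix 4 _⟶_ _⟶*_

  data _⟶_ : Rel State (lsuc 0ℓ) where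
    improve : ∀ {L UB P} (P∈L : P ∈ L) → MinimalKey L P → Improves UB P →
              ⟨ L , UB ⟩ ⟶ ⟨ L ─ P∈L , [ cost (resource (proj₂ P)) ] ⟩
    extend  : ∀ {L UB P} (P∈L : P ∈ L) → MinimalKey L P → ¬ Improves UB P →
              LowerBoundTest UB P →
              ⟨ L , UB ⟩ ⟶ ⟨ (L ─ P∈L) ++ extensions P , UB ⟩
    discard : ∀ {L UB P} (P∈L : P ∈ L) → MinimalKey L P → ¬ Improves UB P →
              ¬ LowerBoundTest UB P →
              ⟨ L , UB ⟩ ⟶ ⟨ L ─ P∈L , UB ⟩

  _⟶*_ : Rel State (lsuc 0ℓ)
  _⟶*_ = Star _⟶_

  -- Every run from the given state reaches an empty list after finitely many
  -- iterations. Requiring a successor in `iterate` excludes runs that get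
  -- stuck with a nonempty list.

  data Terminates : Pred State (lsuc 0ℓ) where
    stop    : ∀ {UB} → Terminates ⟨ [] , UB ⟩
    iterate : ∀ {s} → ∃ (s ⟶_) → (∀ {s′} → s ⟶ s′ → Terminates s′) →
              Terminates s

  Correct : Pred (ℝ ⁺) (lsuc 0ℓ)
  Correct UB =
    (∀ {u} → UB ≡ [ u ] → ∃ λ P → Optimal P × u ≈ᴿ cost (resource P)) ×
    (UB ≡ ⊤⁺ → ¬ ∃ Feasible)

{-# OPTIONS --safe #-}

-- Correctness: throughout a run, every feasible o-d path Q either costs at least
-- UB or has a prefix in the list. Extending P keeps a prefix of Q unless P = Q;
-- P is discarded only if UB is at most its key, and the key of a prefix of Q is at
-- most the cost of Q. When P ends at d and improves UB it is not extended, which is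
-- harmless because closed paths at d have nonnegative resource.
--
-- Termination: it suffices to bound the length of the extended paths, since the
-- tree of all extensions is finitely branching. The key of an extended path P is
-- at most the cost of (B)'s path: by the lower bound test once UB has reached that
-- cost, and before because a prefix of (B)'s path is in the list and P has minimal
-- key. Hence x_P ⊕ b_v ≤ x_M, and by (W) each positive summand is repeated only
-- boundedly often in x_P. In case (b) the summands are the arcs of P; in case (c)
-- they are the cycles removed by loop erasure, of which there are finitely many.

module Submission where

open import Defs
open import Algebra.Bundles using (CommutativeMonoid)
import Algebra.Properties.CommutativeSemigroup as CommutativeSemigroupProperties
open import Algebra.Structures using (IsMonoid)
open import Axiom.ExcludedMiddle using (ExcludedMiddle)
open import Axiom.UniquenessOfIdentityProofs using (module Decidable⇒UIP)
open import Data.Empty using (⊥-elim)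
open import Data.Fin.Base as Fin using (Fin; zero; suc)
open import Data.Fin.Patterns using (0F)
import Data.Fin.Properties as Fin
open import Data.List.Base as List
  using (List; []; _∷_; _++_; map; concatMap; filter; foldr; length; lookup; allFin; tabulate)
open import Data.List.Membership.Propositional using (_∈_; lose)
open import Data.List.Membership.Propositional.Properties
  using (∈-map⁺; ∈-++⁺ˡ; ∈-++⁺ʳ; ∈-concatMap⁺; ∈-filter⁺; ∈-filter⁻; ∈-lookup; ∈-allFin)
import Data.List.Properties as List
open import Data.List.Relation.Binary.Permutation.Propositional as ↭
  using (_↭_; ↭-refl; prep; swap)
import Data.List.Relation.Binary.Permutation.Propositional.Properties as ↭
open import Data.List.Relation.Unary.All as All using (All; []; _∷_)
import Data.List.Relation.Unary.All.Properties as All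
open import Data.List.Relation.Unary.AllPairs using ([]; _∷_)
open import Data.List.Relation.Unary.Any as Any using (here; there; _─_)
import Data.List.Relation.Unary.Any.Properties as Any
open import Data.List.Relation.Unary.Unique.Propositional using (Unique)
import Data.Maybe.Base as Maybe
import Data.Maybe.Relation.Unary.Any as MAny
open import Data.Nat.Base as ℕ using (ℕ; zero; suc; _+_; _*_; _∸_; _⊔_; z≤n; s≤s)
open import Data.Nat.Induction using (<-wellFounded)
open import Data.Nat.ListAction using (sum)
open import Data.Nat.ListAction.Properties using (sum-++; sum-↭)
import Data.Nat.Properties as ℕ
open import Data.Product using (∃; ∃₂; _×_; _,_; proj₁; proj₂)
import Data.Rational.Base as ℚ
import Data.Rational.Properties as ℚ
open import Data.Sum using (_⊎_; inj₁; inj₂; [_,_]′)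
open import Function using (_∘_; id; Equivalence)
open import Induction.WellFounded using (Acc; acc)
open import Relation.Binary.Construct.Add.Supremum.NonStrict
  using ([_]; _≤⊤⁺; ≤⁺-trans; [≤]-injective)
open import Relation.Binary.Construct.Add.Supremum.Strict using ([_]; [_]<⊤⁺)
open import Relation.Binary.Construct.Closure.ReflexiveTransitive using (ε; _◅_; _◅◅_)
open import Relation.Binary.Construct.Closure.ReflexiveTransitive.Properties using (◅◅-assoc)
open import Relation.Binary.Core using (Rel)
open import Relation.Binary.Definitions using (Total; tri<; tri≈; tri>)
open import Relation.Binary.Lattice.Structures using (IsLattice)
open import Relation.Binary.PropositionalEquality
  using (_≡_; refl; sym; trans; cong; subst)
open import Relation.Nullary using (¬_; Dec; yes; no; contradiction)
open import Relation.Nullary.Construct.Add.Supremum using ([_]; ⊤⁺)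
open import Relation.Nullary.Decidable using (dec⇒maybe; dec-yes-irr)

-- Order on the cuts and on their extension by +∞.

≤ᴿ-trans : ∀ x y z → x ≤ᴿ y → y ≤ᴿ z → x ≤ᴿ z
≤ᴿ-trans _ _ _ x≤y y≤z = y≤z ∘ x≤y

Lower-<-Upper : ∀ x {p q} → ℝ.Lower x p → ℝ.Upper x q → p ℚ.< q
Lower-<-Upper x {p} {q} p∈L q∈U with p ℚ.<? q
... | yes p<q = p<q
... | no  p≮q with ℚ.<-cmp p q
...   | tri< p<q _ _ = contradiction p<q p≮q
...   | tri≈ _ refl _ = ⊥-elim (ℝ.disjoint x p (p∈L , q∈U))
...   | tri> _ _ q<p =
        ⊥-elim (ℝ.disjoint x q (Equivalence.from (ℝ.lower-rounded x q) (p , q<p , p∈L) , q∈U))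

<ᴿ⇒≤ᴿ : ∀ x y → x <ᴿ y → x ≤ᴿ y
<ᴿ⇒≤ᴿ x y (q , q∈Ux , q∈Ly) p∈Lx =
  Equivalence.from (ℝ.lower-rounded y _) (q , Lower-<-Upper x p∈Lx q∈Ux , q∈Ly)

-- Locatedness decides only across a gap. Roundedness supplies one: some `r` above `p` still lies
-- below `y`, and `r` above `x` would witness `x <ᴿ y`.
≮ᴿ⇒≥ᴿ : ∀ x y → ¬ x <ᴿ y → y ≤ᴿ x
≮ᴿ⇒≥ᴿ x y x≮y p∈Ly with Equivalence.to (ℝ.lower-rounded y _) p∈Ly
... | r , p<r , r∈Ly with ℝ.located x p<r
...   | inj₁ p∈Lx = p∈Lx
...   | inj₂ r∈Ux = ⊥-elim (x≮y (r , r∈Ux , r∈Ly))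

≤ᴿ-total : (∀ {ℓ} → ExcludedMiddle ℓ) → ∀ x y → x ≤ᴿ y ⊎ y ≤ᴿ x
≤ᴿ-total em x y with em {P = x <ᴿ y}
... | yes x<y = inj₁ (<ᴿ⇒≤ᴿ x y x<y)
... | no  x≮y = inj₂ (≮ᴿ⇒≥ᴿ x y x≮y)

<ᴿ⁺⇒≤ᴿ⁺ : ∀ x y → [ x ] <ᴿ⁺ y → [ x ] ≤ᴿ⁺ y
<ᴿ⁺⇒≤ᴿ⁺ x [ y ] [ x<y ]   = [ <ᴿ⇒≤ᴿ x y x<y ]
<ᴿ⁺⇒≤ᴿ⁺ x ⊤⁺    [ x ]<⊤⁺ = [ x ] ≤⊤⁺

≤ᴿ⁺-trans : ∀ {x y z} → x ≤ᴿ⁺ y → y ≤ᴿ⁺ z → x ≤ᴿ⁺ z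
≤ᴿ⁺-trans = ≤⁺-trans _≤ᴿ_ (λ {x} {y} {z} → ≤ᴿ-trans x y z)

≮ᴿ⁺⇒≥ᴿ⁺ : ∀ x y → ¬ [ x ] <ᴿ⁺ y → y ≤ᴿ⁺ [ x ]
≮ᴿ⁺⇒≥ᴿ⁺ x [ y ] x≮y = [ ≮ᴿ⇒≥ᴿ x y (x≮y ∘ [_]) ]
≮ᴿ⁺⇒≥ᴿ⁺ x ⊤⁺    x≮⊤ = contradiction [ x ]<⊤⁺ x≮⊤

-- Finite lists: removal, minima, common bounds.

module _ {a} {A : Set a} where

  -- Serves twice: to tell whether a listed prefix is the path being removed, and to split the
  -- weight of that path off the measure.
  ─-↭ : ∀ {x : A} {xs} (x∈xs : x ∈ xs) → xs ↭ x ∷ (xs ─ x∈xs)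
  ─-↭ (here refl)              = ↭-refl
  ─-↭ {x} {y ∷ _} (there x∈xs) = ↭.trans (prep y (─-↭ x∈xs)) (swap y x ↭-refl)

  lookup-injective : ∀ {xs : List A} → Unique xs →
                     ∀ i j → lookup xs i ≡ lookup xs j → i ≡ j
  lookup-injective (x∉xs ∷ _) zero    zero    _  = refl
  lookup-injective (x∉xs ∷ _) zero    (suc j) eq = contradiction eq (All.lookup x∉xs (∈-lookup j))
  lookup-injective (x∉xs ∷ _) (suc i) zero    eq = contradiction (sym eq) (All.lookup x∉xs (∈-lookup i))
  lookup-injective (_ ∷ xs!)  (suc i) (suc j) eq = cong suc (lookup-injective xs! i j eq)

  ∃-minimal : ∀ {ℓ b} {B : Set b} {_≲_ : Rel B ℓ} →
              (∀ x y z → x ≲ y → y ≲ z → x ≲ z) → Total _≲_ → (f : A → B) →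
              ∀ x xs → ∃ λ m → m ∈ x ∷ xs × (∀ {y} → y ∈ x ∷ xs → f m ≲ f y)
  ∃-minimal {_≲_ = _≲_} ≲-trans ≲-total f = minimal
    where
    ≲-refl : ∀ x → x ≲ x
    ≲-refl x = [ id , id ]′ (≲-total x x)
    minimal : ∀ x xs → ∃ λ m → m ∈ x ∷ xs × (∀ {y} → y ∈ x ∷ xs → f m ≲ f y)
    minimal x [] = x , here refl , λ { (here refl) → ≲-refl (f x) }
    minimal x (y ∷ ys) with minimal y ys
    ... | m , m∈ , m≲ with ≲-total (f x) (f m)
    ...   | inj₁ x≲m = x , here refl ,
            λ { (here refl) → ≲-refl (f x) ; (there z∈) → ≲-trans _ _ _ x≲m (m≲ z∈) }
    ...   | inj₂ m≲x = m , there m∈ ,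
            λ { (here refl) → m≲x ; (there z∈) → m≲ z∈ }

  ∃-common-bound : ∀ {ℓ} {P : A → ℕ → Set ℓ} →
                   (∀ {x m n} → m ℕ.≤ n → P x m → P x n) → (∀ x → ∃ (P x)) →
                   ∀ xs → ∃ λ n → All (λ x → P x n) xs
  ∃-common-bound mono bound []       = 0 , []
  ∃-common-bound mono bound (x ∷ xs) with bound x | ∃-common-bound mono bound xs
  ... | m , Pm | n , Pn =
    m ⊔ n , mono (ℕ.m≤m⊔n m n) Pm ∷ All.map (mono (ℕ.m≤n⊔m m n)) Pn

-- Counting in lists over a finite set.

Unique⇒length≤ : ∀ {n} {is : List (Fin n)} → Unique is → length is ℕ.≤ n
Unique⇒length≤ is! = Fin.injective⇒≤ (λ {i} {j} → lookup-injective is! i j)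

sum-tabulate-mono : ∀ {k} {f g : Fin k → ℕ} → (∀ i → f i ℕ.≤ g i) →
                    sum (tabulate f) ℕ.≤ sum (tabulate g)
sum-tabulate-mono {zero}  f≤g = z≤n
sum-tabulate-mono {suc k} f≤g = ℕ.+-mono-≤ (f≤g zero) (sum-tabulate-mono (f≤g ∘ suc))

sum-tabulate-mono-< : ∀ {k} {f g : Fin k → ℕ} → (∀ i → f i ℕ.≤ g i) →
                      ∀ j → f j ℕ.< g j → sum (tabulate f) ℕ.< sum (tabulate g)
sum-tabulate-mono-< f≤g zero    f<g = ℕ.+-mono-<-≤ f<g (sum-tabulate-mono (f≤g ∘ suc))
sum-tabulate-mono-< f≤g (suc j) f<g = ℕ.+-mono-≤-< (f≤g zero) (sum-tabulate-mono-< (f≤g ∘ suc) j f<g)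

occurrences : ∀ {k} → Fin k → List (Fin k) → ℕ
occurrences i = length ∘ filter (i Fin.≟_)

occurrences-∷ : ∀ {k} (i j : Fin k) js → occurrences i js ℕ.≤ occurrences i (j ∷ js)
occurrences-∷ i j js with i Fin.≟ j
... | yes _ = ℕ.n≤1+n _
... | no  _ = ℕ.≤-refl

occurrences-here : ∀ {k} (j : Fin k) js → occurrences j js ℕ.< occurrences j (j ∷ js)
occurrences-here j js with j Fin.≟ j
... | yes _  = ℕ.≤-refl
... | no j≢j = contradiction refl j≢j

-- Pigeonhole in additive form: prepending `j` raises the count of `j` and lowers no other, so
-- bounds on all counts bound the length.
length≤sum-occurrences : ∀ {k} (is : List (Fin k)) →
                         length is ℕ.≤ sum (tabulate (λ i → occurrences i is))
length≤sum-occurrences []       = z≤n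
length≤sum-occurrences (j ∷ js) = ℕ.≤-<-trans (length≤sum-occurrences js)
  (sum-tabulate-mono-< (λ i → occurrences-∷ i j js) j (occurrences-here j js))

-- Recodes members by positions, so that `occurrences` can count objects such as cycles by equality
-- in `Fin`.
∈⇒map-lookup : ∀ {a} {A : Set a} {xs ys : List A} → All (_∈ xs) ys →
               ∃ λ is → map (lookup xs) is ≡ ys
∈⇒map-lookup []          = [] , refl
∈⇒map-lookup (y∈ ∷ ys∈) with ∈⇒map-lookup ys∈
... | is , refl = Any.index y∈ ∷ is , cong (_∷ _) (sym (Any.lookup-index y∈))

-- Lattice ordered monoids: multiples and bounded sums.

module LatticeOrderedMonoidProperties {c ℓ₁ ℓ₂} (M : LatticeOrderedMonoid c ℓ₁ ℓ₂) where
  open LatticeOrderedMonoid M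
  open IsLattice isLattice public using (antisym)
    renaming (refl to ≤-refl; trans to ≤-trans; reflexive to ≤-reflexive)
  open IsMonoid isMonoid public
    using (identityˡ; identityʳ; assoc; ∙-cong) renaming (refl to ≈-refl; sym to ≈-sym; trans to ≈-trans)

  commutativeMonoid : Commutative → CommutativeMonoid c ℓ₁
  commutativeMonoid comm = record { isCommutativeMonoid = record { isMonoid = isMonoid ; comm = comm } }

  y≤x⊕y : ∀ {x y} → 𝟎 ≤ x → y ≤ x ⊕ y
  y≤x⊕y 0≤x = ≤-trans (≤-reflexive (≈-sym (identityˡ _))) (⊕-isotoneˡ _ 0≤x)

  x≤x⊕y : ∀ {x y} → 𝟎 ≤ y → x ≤ x ⊕ y
  x≤x⊕y 0≤y = ≤-trans (≤-reflexive (≈-sym (identityʳ _))) (⊕-isotoneʳ _ 0≤y)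

  ≤-<⋁-trans : ∀ {y z} → y ≤ z → z <⋁ → y <⋁
  ≤-<⋁-trans y≤z ([ t ] , ⋁ , [ z≤t , z≉t ]) = [ t ] , ⋁ , [ ≤-trans y≤z z≤t ,
    (λ y≈t → z≉t (antisym z≤t (≤-trans (≤-reflexive (≈-sym y≈t)) y≤z))) ]
  ≤-<⋁-trans y≤z (⊤⁺ , ⋁ , [ _ ]<⊤⁺) = ⊤⁺ , ⋁ , [ _ ]<⊤⁺

  ·-mono : ∀ {m n x} → 𝟎 ≤ x → m ℕ.≤ n → m · x ≤ n · x
  ·-mono {n = zero}  0≤x z≤n       = ≤-refl
  ·-mono {n = suc n} 0≤x z≤n       = ≤-trans (·-mono 0≤x (z≤n {n})) (y≤x⊕y 0≤x)
  ·-mono             0≤x (s≤s m≤n) = ⊕-isotoneʳ _ (·-mono 0≤x m≤n)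

  ∑ : ∀ {a} {A : Set a} → (A → Carrier) → List A → Carrier
  ∑ f = foldr (λ i → f i ⊕_) 𝟎

  -- Nothing is moved past another term, as case (b) requires: copies of `κ i` stay in place and the
  -- other terms are dropped as nonnegative.
  occurrences-·-≤-∑ : ∀ {k} {κ : Fin k → Carrier} → (∀ i → 𝟎 ≤ κ i) →
                      ∀ i is → occurrences i is · κ i ≤ ∑ κ is
  occurrences-·-≤-∑ 0≤κ i []       = ≤-refl
  occurrences-·-≤-∑ 0≤κ i (j ∷ js) with i Fin.≟ j
  ... | yes refl = ⊕-isotoneʳ _ (occurrences-·-≤-∑ 0≤κ i js)
  ... | no  _    = ≤-trans (occurrences-·-≤-∑ 0≤κ i js) (y≤x⊕y (0≤κ j))

  module _ (em : ∀ {ℓ} → ExcludedMiddle ℓ) (W : AssumptionW) {x_M} (x_M<⋁ : x_M <⋁) where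

    -- (W) speaks only of elements below the join of the carrier. If `z ≤ x_M`, then `z` is one of
    -- them; otherwise zero copies of `x` suffice.
    ∃-multiple-≰ : ∀ {x} z → 𝟎 < x → ∃ λ n → ¬ ((n · x) ⊕ z ≤ x_M)
    ∃-multiple-≰ z 0<x with em {P = z ≤ x_M}
    ... | yes z≤ = W (≤-<⋁-trans z≤ x_M<⋁) x_M<⋁ 0<x
    ... | no  z≰ = 0 , λ z≤ → z≰ (≤-trans (≤-reflexive (≈-sym (identityˡ z))) z≤)

    -- In a long sum some κ i is repeated too often, wherever the repetitions
    -- stand: the other terms are positive, so deleting them only decreases the sum.
    ∑-bounded⇒length-bounded : ∀ {k} {κ : Fin k → Carrier} → (∀ i → 𝟎 < κ i) → ∀ z →
      ∃ λ N → ∀ is → ∑ κ is ⊕ z ≤ x_M → length is ℕ.≤ N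
    -- Together with `z`, already `n i` copies of `κ i` overshoot `x_M`, so each index `i` occurs at
    -- most `n i` times.
    ∑-bounded⇒length-bounded {κ = κ} 0<κ z = sum (tabulate n) , λ is ∑≤ →
      ℕ.≤-trans (length≤sum-occurrences is)
        (sum-tabulate-mono λ i → ℕ.≮⇒≥ λ n<occ →
          proj₂ (∃-multiple-≰ z (0<κ i))
            (≤-trans
              (⊕-isotoneˡ z (≤-trans (·-mono (proj₁ (0<κ i)) (ℕ.<⇒≤ n<occ))
                                     (occurrences-·-≤-∑ (proj₁ ∘ 0<κ) i is)))
              ∑≤))
      where
      n : _ → ℕ
      n i = proj₁ (∃-multiple-≰ z (0<κ i))

-- Paths, their enumeration, and loop erasure.

module DigraphProperties (D : Digraph) where
  open Digraph D

  ∣_∣ : ∀ {u v} → Path u v → ℕ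
  ∣ ε ∣     = 0
  ∣ a ◅ P ∣ = suc ∣ P ∣

  ∣◅◅∣ : ∀ {u v w} (P : Path u v) (Q : Path v w) → ∣ P ◅◅ Q ∣ ≡ ∣ P ∣ + ∣ Q ∣
  ∣◅◅∣ ε       Q = refl
  ∣◅◅∣ (a ◅ P) Q = cong suc (∣◅◅∣ P Q)

  ◅◅-identityʳ : ∀ {u v} (P : Path u v) → P ◅◅ ε ≡ P
  ◅◅-identityʳ ε       = refl
  ◅◅-identityʳ (a ◅ P) = cong (a ◅_) (◅◅-identityʳ P)

  arcs : ∀ {u v} → Path u v → List Arc
  arcs ε             = []
  arcs ((a , _) ◅ P) = a ∷ arcs P

  length-arcs : ∀ {u v} (P : Path u v) → length (arcs P) ≡ ∣ P ∣
  length-arcs ε       = refl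
  length-arcs (a ◅ P) = cong suc (length-arcs P)

  ∈-outgoing : ∀ {v w} (a : ArcBetween v w) → (w , a) ∈ outgoing v
  ∈-outgoing {v} (a , eq , refl) = Any.mapMaybe⁺ _ (allFin ∣A∣)
    (Any.map⁺ (lose (∈-allFin a) found))
    where
    found : MAny.Any ((head a , a , eq , refl) ≡_)
              (Maybe.map (λ tail≡v → head a , a , tail≡v , refl) (dec⇒maybe (tail a Fin.≟ v)))
    -- `outgoing` stores the equality found by the decision procedure; uniqueness of identity proofs
    -- makes it the one carried by the given arc.
    found rewrite dec-yes-irr (tail a Fin.≟ v) (Decidable⇒UIP.≡-irrelevant Fin._≟_) eq = MAny.just refl

  ∈-extensions : ∀ {o v w} (P : Path o v) (a : ArcBetween v w) →
                 (w , P ◅◅ (a ◅ ε)) ∈ extensions (v , P)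
  ∈-extensions P a = ∈-map⁺ _ (∈-outgoing a)

  ∣extensions∣ : ∀ {o} (P : PathFrom o) →
                 All (λ Q → ∣ proj₂ Q ∣ ≡ suc ∣ proj₂ P ∣) (extensions P)
  ∣extensions∣ (v , P) = All.map⁺ (All.universal
    (λ (w , a) → trans (∣◅◅∣ P (a ◅ ε)) (ℕ.+-comm _ 1)) (outgoing v))

  pathsFrom : ℕ → ∀ u → List (PathFrom u)
  pathsFrom zero    u = (u , ε) ∷ []
  pathsFrom (suc n) u = (u , ε) ∷
    concatMap (λ (w , a) → map (λ (v , P) → v , a ◅ P) (pathsFrom n w)) (outgoing u)

  ∈-pathsFrom : ∀ {n u v} (P : Path u v) → ∣ P ∣ ℕ.≤ n → (v , P) ∈ pathsFrom n u
  ∈-pathsFrom {zero}  ε       _         = here refl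
  ∈-pathsFrom {suc n} ε       _         = here refl
  ∈-pathsFrom {suc n} (a ◅ P) (s≤s P≤n) = there (∈-concatMap⁺ _
    (lose (∈-outgoing a) (∈-map⁺ _ (∈-pathsFrom P P≤n))))

  vertices : ∀ {u v} → Path u v → List Vertex
  vertices {u} ε       = u ∷ []
  vertices {u} (a ◅ P) = u ∷ vertices P

  Elementary : ∀ {u v} → Path u v → Set
  Elementary P = Unique (vertices P)

  length-vertices : ∀ {u v} (P : Path u v) → length (vertices P) ≡ suc ∣ P ∣
  length-vertices ε       = refl
  length-vertices (a ◅ P) = cong suc (length-vertices P)

  Elementary⇒∣∣< : ∀ {u v} (P : Path u v) → Elementary P → ∣ P ∣ ℕ.< ∣V∣
  Elementary⇒∣∣< P P! = subst (ℕ._≤ ∣V∣) (length-vertices P) (Unique⇒length≤ P!)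

  Elementary-suffix : ∀ {u v w} (P : Path u v) (Q : Path v w) → Elementary (P ◅◅ Q) → Elementary Q
  Elementary-suffix ε       Q Q!       = Q!
  Elementary-suffix (a ◅ P) Q (_ ∷ R!) = Elementary-suffix P Q R!

  splitAt : ∀ {u v w} (P : Path u v) → w ∈ vertices P →
            ∃₂ λ (Q : Path u w) (R : Path w v) → Q ◅◅ R ≡ P
  splitAt ε       (here refl) = ε , ε , refl
  splitAt (a ◅ P) (here refl) = ε , a ◅ P , refl
  splitAt (a ◅ P) (there w∈)  with splitAt P w∈
  ... | Q , R , refl = a ◅ Q , R , refl

  -- Erasure starts at the far end of P: E is the elementary path left over, Cs the
  -- erased cycles.
  data LoopErasure : ∀ {u v} → Path u v → Path u v → List Cycle → Set where
    ε    : ∀ {u} → LoopErasure {u} ε ε []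
    keep : ∀ {u v w Cs} (a : ArcBetween u v) {P E : Path v w} →
           ¬ (u ∈ vertices E) → LoopErasure P E Cs → LoopErasure (a ◅ P) (a ◅ E) Cs
    loop : ∀ {u v w Cs} (a : ArcBetween u v) {P : Path v w} (E₁ : Path v u) {E₂ : Path u w} →
           LoopErasure P (E₁ ◅◅ E₂) Cs →
           LoopErasure (a ◅ P) E₂ ((u , a ◅ E₁ , λ ()) ∷ Cs)

  loopErasure : ∀ {u v} (P : Path u v) → ∃₂ (LoopErasure P)
  loopErasure ε = ε , [] , ε
  loopErasure {u} (a ◅ P) with loopErasure P
  ... | E , Cs , le with Any.any? (u Fin.≟_) (vertices E)
  ...   | no  u∉ = a ◅ E , Cs , keep a u∉ le
  -- The tail of the new arc already lies on `E`: the arc and the piece of `E` up to that vertex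
  -- form the erased cycle.
  ...   | yes u∈ with splitAt E u∈
  ...     | E₁ , E₂ , refl = E₂ , _ , loop a E₁ le

  LoopErasure⇒Elementary : ∀ {u v} {P E : Path u v} {Cs} → LoopErasure P E Cs → Elementary E
  LoopErasure⇒Elementary ε              = [] ∷ []
  LoopErasure⇒Elementary (keep a u∉ le) = All.¬Any⇒All¬ _ u∉ ∷ LoopErasure⇒Elementary le
  LoopErasure⇒Elementary (loop a E₁ le) = Elementary-suffix E₁ _ (LoopErasure⇒Elementary le)

  ShortCycle : Cycle → Set
  ShortCycle (_ , C , _) = ∣ C ∣ ℕ.≤ ∣V∣

  -- `E₁` begins an elementary path. The strict inequality leaves room for the arc that closes the
  -- cycle: `a ◅ E₁` has at most `∣V∣` arcs.
  erased-short : ∀ {u v w Cs} {P : Path v w} (E₁ : Path v u) (E₂ : Path u w) →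
                 LoopErasure P (E₁ ◅◅ E₂) Cs → ∣ E₁ ∣ ℕ.< ∣V∣
  erased-short E₁ E₂ le =
    ℕ.≤-<-trans (subst (∣ E₁ ∣ ℕ.≤_) (sym (∣◅◅∣ E₁ E₂)) (ℕ.m≤m+n _ _))
                (Elementary⇒∣∣< (E₁ ◅◅ E₂) (LoopErasure⇒Elementary le))

  LoopErasure⇒ShortCycles : ∀ {u v} {P E : Path u v} {Cs} → LoopErasure P E Cs → All ShortCycle Cs
  LoopErasure⇒ShortCycles ε              = []
  LoopErasure⇒ShortCycles (keep a u∉ le) = LoopErasure⇒ShortCycles le
  LoopErasure⇒ShortCycles (loop a E₁ le) = erased-short E₁ _ le ∷ LoopErasure⇒ShortCycles le

  -- Every arc of `P` ends up in `E` or in one of the erased cycles, each of which has at most `∣V∣`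
  -- arcs.
  LoopErasure-∣∣≤ : ∀ {u v} {P E : Path u v} {Cs} → LoopErasure P E Cs →
                    ∣ P ∣ ℕ.≤ length Cs * ∣V∣ + ∣ E ∣
  LoopErasure-∣∣≤ ε = z≤n
  LoopErasure-∣∣≤ {Cs = Cs} (keep a {P} {E} u∉ le) = begin
    suc ∣ P ∣                      ≤⟨ s≤s (LoopErasure-∣∣≤ le) ⟩
    suc (length Cs * ∣V∣ + ∣ E ∣)  ≡⟨ ℕ.+-suc (length Cs * ∣V∣) ∣ E ∣ ⟨
    length Cs * ∣V∣ + suc ∣ E ∣    ∎
    where open ℕ.≤-Reasoning
  LoopErasure-∣∣≤ (loop {Cs = Cs} a {P} E₁ {E₂} le) = begin
    suc ∣ P ∣                          ≤⟨ s≤s (LoopErasure-∣∣≤ le) ⟩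
    suc (s + ∣ E₁ ◅◅ E₂ ∣)             ≡⟨ cong (λ n → suc (s + n)) (∣◅◅∣ E₁ E₂) ⟩
    suc (s + (∣ E₁ ∣ + ∣ E₂ ∣))        ≡⟨ cong suc (ℕ.+-assoc s ∣ E₁ ∣ ∣ E₂ ∣) ⟨
    suc (s + ∣ E₁ ∣ + ∣ E₂ ∣)          ≡⟨ cong (λ n → suc (n + ∣ E₂ ∣)) (ℕ.+-comm s ∣ E₁ ∣) ⟩
    suc ∣ E₁ ∣ + s + ∣ E₂ ∣            ≤⟨ ℕ.+-monoˡ-≤ ∣ E₂ ∣ (ℕ.+-monoˡ-≤ s (erased-short E₁ E₂ le)) ⟩
    ∣V∣ + s + ∣ E₂ ∣                   ∎
    where
    open ℕ.≤-Reasoning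
    s = length Cs * ∣V∣

-- Resources of paths and bounds on path length.

module ProblemProperties {c ℓ₁ ℓ₂} {M : LatticeOrderedMonoid c ℓ₁ ℓ₂} (I : Problem M) where
  open LatticeOrderedMonoid M
  open LatticeOrderedMonoidProperties M
  open Problem I
  open DigraphProperties digraph

  resource-◅◅ : ∀ {u v w} (P : Path u v) (Q : Path v w) →
                resource (P ◅◅ Q) ≈ resource P ⊕ resource Q
  resource-◅◅ ε       Q = ≈-sym (identityˡ _)
  resource-◅◅ (a ◅ P) Q = ≈-trans (∙-cong ≈-refl (resource-◅◅ P Q)) (≈-sym (assoc _ _ _))

  resource-arcs : ∀ {u v} (P : Path u v) → ∑ x (arcs P) ≡ resource P
  resource-arcs ε       = refl
  resource-arcs (a ◅ P) = cong (_ ⊕_) (resource-arcs P)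

  Walk : Set
  Walk = ∃ PathFrom

  walkResource : Walk → Carrier
  walkResource (_ , _ , P) = resource P

  -- Drops the proof of nonemptiness, so that an erased cycle can be a literal member of
  -- `shortWalks`.
  cycleWalk : Cycle → Walk
  cycleWalk (v , C , _) = v , v , C

  shortWalks : List Walk
  shortWalks = concatMap (λ u → map (u ,_) (pathsFrom ∣V∣ u)) (allFin ∣V∣)

  ∈-shortWalks : ∀ {u v} (P : Path u v) → ∣ P ∣ ℕ.≤ ∣V∣ → (u , v , P) ∈ shortWalks
  ∈-shortWalks {u} P P≤ = ∈-concatMap⁺ (λ u → map (u ,_) (pathsFrom ∣V∣ u))
    (lose (∈-allFin u) (∈-map⁺ (u ,_) (∈-pathsFrom P P≤)))

  module _ (comm : Commutative) where
    open CommutativeSemigroupProperties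
      (CommutativeMonoid.commutativeSemigroup (commutativeMonoid comm))
      using (x∙yz≈y∙xz)

    -- Commutativity moves a kept arc in front of the cycles, and the piece `E₁` past the earlier
    -- cycles to rejoin `E₂`.
    resource-LoopErasure : ∀ {u v} {P E : Path u v} {Cs} → LoopErasure P E Cs →
                           ∑ (walkResource ∘ cycleWalk) Cs ⊕ resource E ≈ resource P
    resource-LoopErasure ε = identityˡ _
    resource-LoopErasure (keep a u∉ le) =
      ≈-trans (x∙yz≈y∙xz _ _ _) (∙-cong ≈-refl (resource-LoopErasure le))
    resource-LoopErasure (loop a E₁ {E₂} le) =
      ≈-trans (assoc _ _ _) (≈-trans (assoc _ _ _) (∙-cong ≈-refl
        (≈-trans (x∙yz≈y∙xz _ _ _)
          (≈-trans (∙-cong ≈-refl (≈-sym (resource-◅◅ E₁ E₂))) (resource-LoopErasure le)))))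

  positiveArcs⇒path≥𝟎 : (∀ a → 𝟎 < x a) → ∀ {u v} (P : Path u v) → 𝟎 ≤ resource P
  positiveArcs⇒path≥𝟎 0<x ε             = ≤-refl
  positiveArcs⇒path≥𝟎 0<x ((a , _) ◅ P) =
    ≤-trans (positiveArcs⇒path≥𝟎 0<x P) (y≤x⊕y (proj₁ (0<x a)))

  positiveCycles⇒closedPath≥𝟎 : PositiveCycles → ∀ {v} (C : Path v v) → 𝟎 ≤ resource C
  positiveCycles⇒closedPath≥𝟎 0<cycle ε       = ≤-refl
  positiveCycles⇒closedPath≥𝟎 0<cycle (a ◅ C) = proj₁ (0<cycle (_ , a ◅ C , λ ()))

  -- Loop erasure finds no cycle to remove, so `P` is no longer than an elementary path.
  Acyclic⇒length-bounded : Acyclic → ∀ {u v} (P : Path u v) → ∣ P ∣ ℕ.≤ ∣V∣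
  Acyclic⇒length-bounded acyclic P with loopErasure P
  ... | E , C ∷ _ , le = contradiction C acyclic
  ... | E , []    , le = ℕ.≤-trans (LoopErasure-∣∣≤ le)
                                   (ℕ.<⇒≤ (Elementary⇒∣∣< E (LoopErasure⇒Elementary le)))

  module _ (em : ∀ {ℓ} → ExcludedMiddle ℓ) (W : AssumptionW) {x_M} (x_M<⋁ : x_M <⋁) where

    positiveArcs⇒length-bounded : (∀ a → 𝟎 < x a) →
      ∃ λ N → ∀ {u v} (P : Path u v) → resource P ≤ x_M → ∣ P ∣ ℕ.≤ N
    positiveArcs⇒length-bounded 0<x with ∑-bounded⇒length-bounded em W x_M<⋁ 0<x 𝟎
    ... | N , bound = N , λ P P≤ → subst (ℕ._≤ N) (length-arcs P) (bound (arcs P)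
      (≤-trans (≤-reflexive (identityʳ _)) (subst (_≤ x_M) (sym (resource-arcs P)) P≤)))

    -- By commutativity a path is worth its erased short cycles plus an elementary
    -- path; both range over finite sets.
    positiveCycles⇒length-bounded : Commutative → PositiveCycles → ∀ o (b : Vertex → Carrier) →
      ∃ λ N → ∀ {v} (P : Path o v) → resource P ⊕ b v ≤ x_M → ∣ P ∣ ℕ.≤ N
    positiveCycles⇒length-bounded comm 0<cycle o b = N * ∣V∣ + ∣V∣ , bounded
      where
      positive? : ∀ w → Dec (𝟎 < walkResource w)
      positive? w = em

      -- `shortWalks` also holds walks that are not cycles, the empty ones among them, whereas `κ`
      -- has to be positive throughout. Short cycles survive the filter by `0<cycle`.
      positiveWalks : List Walk
      positiveWalks = filter positive? shortWalks

      κ : Fin (length positiveWalks) → Carrier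
      κ = walkResource ∘ lookup positiveWalks

      0<κ : ∀ i → 𝟎 < κ i
      0<κ i = proj₂ (∈-filter⁻ positive? {xs = shortWalks} (∈-lookup i))

      Bound : PathFrom o → ℕ → Set _
      Bound (v , E) n = ∀ is → ∑ κ is ⊕ (resource E ⊕ b v) ≤ x_M → length is ℕ.≤ n

      -- The bound from (W) depends on the summand `resource E ⊕ b v`; a maximum over the finitely
      -- many candidates for `E` removes this dependence.
      commonBound : ∃ λ n → All (λ E → Bound E n) (pathsFrom ∣V∣ o)
      commonBound = ∃-common-bound (λ m≤n bound is ∑≤ → ℕ.≤-trans (bound is ∑≤) m≤n)
        (λ (v , E) → ∑-bounded⇒length-bounded em W x_M<⋁ 0<κ (resource E ⊕ b v))
        (pathsFrom ∣V∣ o)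

      N : ℕ
      N = proj₁ commonBound

      bounded : ∀ {v} (P : Path o v) → resource P ⊕ b v ≤ x_M → ∣ P ∣ ℕ.≤ N * ∣V∣ + ∣V∣
      bounded {v} P P≤ with loopErasure P
      ... | E , Cs , le with ∈⇒map-lookup {xs = positiveWalks} (All.map⁺ {f = cycleWalk}
              (All.map (λ {C} short → ∈-filter⁺ positive? (∈-shortWalks _ short) (0<cycle C))
                       (LoopErasure⇒ShortCycles le)))
      ...   | is , is↦Cs = ℕ.≤-trans (LoopErasure-∣∣≤ le)
              (ℕ.+-mono-≤ (ℕ.*-monoˡ-≤ ∣V∣ Cs≤N) E≤V)
        where
        E≤V : ∣ E ∣ ℕ.≤ ∣V∣
        E≤V = ℕ.<⇒≤ (Elementary⇒∣∣< E (LoopErasure⇒Elementary le))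

        ∑κ : ∑ κ is ≡ ∑ (walkResource ∘ cycleWalk) Cs
        ∑κ = trans (sym (List.foldr-map _ _ 𝟎 is))
                   (trans (cong (∑ walkResource) is↦Cs) (List.foldr-map _ _ 𝟎 Cs))

        ∣is∣ : length is ≡ length Cs
        ∣is∣ = trans (sym (List.length-map _ is))
                     (trans (cong length is↦Cs) (List.length-map _ Cs))

        ∑≤ : ∑ κ is ⊕ (resource E ⊕ b v) ≤ x_M
        ∑≤ = ≤-trans (≤-reflexive (≈-trans (≈-sym (assoc _ _ _)) (∙-cong
               (subst (λ y → y ⊕ _ ≈ _) (sym ∑κ) (resource-LoopErasure comm le)) ≈-refl))) P≤

        Cs≤N : length Cs ℕ.≤ N
        Cs≤N = subst (ℕ._≤ N) ∣is∣
          (All.lookup (proj₂ commonBound) (∈-pathsFrom E E≤V) is ∑≤)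

-- Invariant and correctness of the algorithm.

module GeneralizedA*Properties (em : ∀ {ℓ} → ExcludedMiddle ℓ)
  {c ℓ₁ ℓ₂} {M : LatticeOrderedMonoid c ℓ₁ ℓ₂} (I : Problem M)
  (b : Problem.Vertex I → LatticeOrderedMonoid.Carrier M)
  (bounds : Problem.LowerBounds I b)
  where
  open LatticeOrderedMonoid M
  open LatticeOrderedMonoidProperties M
  open Problem I
  open DigraphProperties digraph
  open ProblemProperties I
  open GeneralizedA* I b

  -- Isotonicity of `cost` and `ρ` turns this into what the algorithm relies on: the key of a path
  -- bounds the cost of all its completions, and a failing `ρ` makes them all infeasible.
  bound-prefix : ∀ {u v} (P : Path u v) (R : Path v d) → resource P ⊕ b v ≤ resource (P ◅◅ R)
  bound-prefix P R = ≤-trans (⊕-isotoneʳ _ (bounds R)) (≤-reflexive (≈-sym (resource-◅◅ P R)))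

  ρ-antitone-0 : ∀ {y z} → y ≤ z → ρ z ≡ 0F → ρ y ≡ 0F
  ρ-antitone-0 {y} y≤z ρz≡0 = Fin.≤-antisym (subst (ρ y Fin.≤_) ρz≡0 (ρ-isotone y≤z)) z≤n

  Covered : State → Path o d → Set₁
  Covered ⟨ L , UB ⟩ Q = UB ≤ᴿ⁺ [ cost (resource Q) ] ⊎
    (∃ λ P → P ∈ L × ∃ λ (R : Path (proj₁ P) d) → proj₂ P ◅◅ R ≡ Q)

  -- Once the list is empty, `covered` makes `UB` a lower bound on all feasible costs; `attained`
  -- then makes a finite `UB` optimal.
  record Invariant (s : State) : Set₁ where
    field
      covered  : ∀ Q → Feasible Q → Covered s Q
      attained : ∀ {u} → State.UB s ≡ [ u ] → ∃ λ P → Feasible P × u ≡ cost (resource P)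
  open Invariant

  invariant-initial : Invariant initial
  invariant-initial = record
    { covered  = λ Q _ → inj₂ ((o , ε) , here refl , Q , refl)
    ; attained = λ ()
    }

  minimalKey≤ : ∀ {L UB v} (P : Path o v) → MinimalKey L (v , P) → LowerBoundTest UB (v , P) →
                ∀ Q → Covered ⟨ L , UB ⟩ Q → key (v , P) ≤ᴿ cost (resource Q)
  minimalKey≤ P minimal (_ , key≤) Q (inj₁ UB≤) =
    [≤]-injective _≤ᴿ_ (≤ᴿ⁺-trans key≤ UB≤)
  minimalKey≤ P minimal _ Q (inj₂ (P′ , P′∈L , R , refl)) =
    ≤ᴿ-trans (key (_ , P)) (key P′) (cost (resource Q))
      (minimal P′∈L) (cost-isotone (bound-prefix (proj₂ P′) R))

  extended≤x_M : (B : AssumptionB) → let (_ , _ , x_M , _) = B in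
                 ∀ {L UB v} (P : Path o v) → Invariant ⟨ L , UB ⟩ →
                 MinimalKey L (v , P) → LowerBoundTest UB (v , P) → resource P ⊕ b v ≤ x_M
  extended≤x_M (P₀ , P₀-feasible , _ , _ , x_M-bounds) P inv minimal test =
    x_M-bounds (minimalKey≤ P minimal test P₀ (covered inv P₀ P₀-feasible) , proj₁ test)

  module _ (closed≥𝟎 : ∀ (C : Path d d) → 𝟎 ≤ resource C) where

    invariant-⟶ : ∀ {s s′} → s ⟶ s′ → Invariant s → Invariant s′
    invariant-⟶ (improve {L} {UB} {v , P} P∈L minimal (refl , ρ≡0 , P<UB)) inv = record
      { covered  = λ Q Q-feasible → cover Q (covered inv Q Q-feasible)
      ; attained = λ { refl → P , ρ≡0 , refl }
      }
      where
      c-P = cost (resource P)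
      cover : ∀ Q → Covered ⟨ L , UB ⟩ Q → Covered ⟨ L ─ P∈L , [ c-P ] ⟩ Q
      cover Q (inj₁ UB≤) = inj₁ (≤ᴿ⁺-trans (<ᴿ⁺⇒≤ᴿ⁺ c-P UB P<UB) UB≤)
      -- The permutation separates two cases: the prefix of `Q` is still listed (`there`), or it is
      -- the path just removed (`here`).
      cover Q (inj₂ (P′ , P′∈L , R , eq)) with ↭.∈-resp-↭ (─-↭ P∈L) P′∈L
      cover Q (inj₂ (P′ , P′∈L , R , eq)) | there P′∈ = inj₂ (P′ , P′∈ , R , eq)
      -- `Q` is `P` followed by a closed path at `d`, so its resource is at least that of `P`.
      cover _ (inj₂ (_  , P′∈L , R , refl)) | here refl = inj₁ [ cost-isotone
        (≤-trans (x≤x⊕y (closed≥𝟎 R)) (≤-reflexive (≈-sym (resource-◅◅ P R)))) ]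
    invariant-⟶ (extend {L} {UB} {v , P} P∈L minimal ¬improves test) inv = record
      { covered  = λ Q Q-feasible → cover Q Q-feasible (covered inv Q Q-feasible)
      ; attained = attained inv
      }
      where
      cover : ∀ Q → Feasible Q → Covered ⟨ L , UB ⟩ Q →
              Covered ⟨ (L ─ P∈L) ++ extensions (v , P) , UB ⟩ Q
      cover Q _ (inj₁ UB≤) = inj₁ UB≤
      cover Q _ (inj₂ (P′ , P′∈L , R , eq)) with ↭.∈-resp-↭ (─-↭ P∈L) P′∈L
      cover Q _ (inj₂ (P′ , P′∈L , R , eq)) | there P′∈ = inj₂ (P′ , ∈-++⁺ˡ P′∈ , R , eq)
      -- The next arc `a` of `Q` moves from the remainder to the prefix.
      cover _ _ (inj₂ (_ , P′∈L , a ◅ R , refl)) | here refl =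
        inj₂ (_ , ∈-++⁺ʳ (L ─ P∈L) (∈-extensions P a) , R , ◅◅-assoc P (a ◅ ε) R)
      -- With nothing left, `P` is the feasible path `Q` itself; it did not improve `UB`, so `UB` is
      -- already at most its cost.
      cover Q ρ≡0 (inj₂ (_ , P′∈L , ε , eq)) | here refl = inj₁ (≮ᴿ⁺⇒≥ᴿ⁺ _ UB ¬P<UB)
        where
        P≡Q : P ≡ Q
        P≡Q = trans (sym (◅◅-identityʳ P)) eq
        ¬P<UB : ¬ ([ cost (resource Q) ] <ᴿ⁺ UB)
        ¬P<UB Q<UB = ¬improves (subst (λ R → Improves UB (d , R)) (sym P≡Q) (refl , ρ≡0 , Q<UB))
    invariant-⟶ (discard {L} {UB} {v , P} P∈L minimal ¬improves ¬test) inv = record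
      { covered  = λ Q Q-feasible → cover Q Q-feasible (covered inv Q Q-feasible)
      ; attained = attained inv
      }
      where
      cover : ∀ Q → Feasible Q → Covered ⟨ L , UB ⟩ Q → Covered ⟨ L ─ P∈L , UB ⟩ Q
      cover Q _ (inj₁ UB≤) = inj₁ UB≤
      cover Q _ (inj₂ (P′ , P′∈L , R , eq)) with ↭.∈-resp-↭ (─-↭ P∈L) P′∈L
      cover Q _ (inj₂ (P′ , P′∈L , R , eq)) | there P′∈ = inj₂ (P′ , P′∈ , R , eq)
      -- As `Q` is feasible, the `ρ` part of the test holds for its prefix `P`. The failure lies in
      -- the cost: `UB` is at most the key, which is at most the cost of `Q`.
      cover Q ρ≡0 (inj₂ (_ , P′∈L , R , refl)) | here refl = inj₁ (≤ᴿ⁺-trans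
        (≮ᴿ⁺⇒≥ᴿ⁺ (key (v , P)) UB λ key<UB →
          ¬test (ρ-antitone-0 (bound-prefix P R) ρ≡0 , <ᴿ⁺⇒≤ᴿ⁺ _ UB key<UB))
        [ cost-isotone (bound-prefix P R) ])

    invariant-⟶* : ∀ {s s′} → s ⟶* s′ → Invariant s → Invariant s′
    invariant-⟶* ε        inv = inv
    invariant-⟶* (s ◅ ss) inv = invariant-⟶* ss (invariant-⟶ s inv)

    Invariant⇒Correct : ∀ {UB} → Invariant ⟨ [] , UB ⟩ → Correct UB
    Invariant⇒Correct {UB} inv = finite , infinite
      where
      finite : ∀ {u} → UB ≡ [ u ] → ∃ λ P → Optimal P × u ≈ᴿ cost (resource P)
      finite refl with attained inv refl
      ... | P , ρ≡0 , refl = P , (ρ≡0 , optimal) , id , id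
        where
        optimal : ∀ Q → Feasible Q → cost (resource P) ≤ᴿ cost (resource Q)
        optimal Q Q-feasible with covered inv Q Q-feasible
        ... | inj₁ [ P≤Q ] = P≤Q
        ... | inj₂ (_ , () , _)
      infinite : UB ≡ ⊤⁺ → ¬ ∃ Feasible
      infinite refl (Q , Q-feasible) with covered inv Q Q-feasible
      ... | inj₁ ()
      ... | inj₂ (_ , () , _)

    -- Termination by counting the nodes of trees of extensions.

    module _ (N : ℕ)
      (extended-short : ∀ {L UB v} {P : Path o v} → Invariant ⟨ L , UB ⟩ →
        MinimalKey L (v , P) → LowerBoundTest UB (v , P) → ∣ P ∣ ℕ.≤ N)
      where

      -- Number of nodes in the tree of all extensions of `P`, cut off `k` levels below it.
      treeSize : ℕ → PathFrom o → ℕ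
      treeSize zero    P = 1
      treeSize (suc k) P = suc (sum (map (treeSize k) (extensions P)))

      -- Extended paths have at most `N` arcs, so their extensions have at most `suc N`; at that
      -- length the tree is a single leaf.
      weight : PathFrom o → ℕ
      weight P = treeSize (suc N ∸ ∣ proj₂ P ∣) P

      measure : State → ℕ
      measure ⟨ L , _ ⟩ = sum (map weight L)

      0<treeSize : ∀ k P → 0 ℕ.< treeSize k P
      0<treeSize zero    P = s≤s z≤n
      0<treeSize (suc k) P = s≤s z≤n

      measure-─ : ∀ {L P} (P∈L : P ∈ L) →
                  sum (map weight L) ≡ weight P + sum (map weight (L ─ P∈L))
      measure-─ P∈L = sum-↭ (↭.map⁺ weight (─-↭ P∈L))

      measure-remove : ∀ {L P} (P∈L : P ∈ L) →
                       sum (map weight (L ─ P∈L)) ℕ.< sum (map weight L)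
      measure-remove {P = P} P∈L = subst (sum (map weight (_ ─ P∈L)) ℕ.<_) (sym (measure-─ P∈L))
        (ℕ.+-monoˡ-≤ _ (0<treeSize (suc N ∸ ∣ proj₂ P ∣) P))

      -- As `P` has at most `N` arcs, its tree unfolds once into the trees of its extensions, and
      -- the difference is exactly the node `P`.
      weight-extensions : ∀ P → ∣ proj₂ P ∣ ℕ.≤ N → sum (map weight (extensions P)) ℕ.< weight P
      weight-extensions P P≤N = ℕ.≤-reflexive (trans
        (cong (suc ∘ sum) (List.map-cong-local
          (All.map (λ {Q} ∣Q∣ → cong (λ n → treeSize (suc N ∸ n) Q) ∣Q∣) (∣extensions∣ P))))
        (cong (λ k → treeSize k P) (sym (ℕ.+-∸-assoc 1 P≤N))))

      measure-⟶ : ∀ {s s′} → Invariant s → s ⟶ s′ → measure s′ ℕ.< measure s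
      measure-⟶ inv (improve P∈L _ _)   = measure-remove P∈L
      measure-⟶ inv (discard P∈L _ _ _) = measure-remove P∈L
      measure-⟶ inv (extend {L} {UB} {P} P∈L minimal _ test) = begin-strict
        sum (map weight ((L ─ P∈L) ++ extensions P))  ≡⟨ cong sum (List.map-++ weight (L ─ P∈L) (extensions P)) ⟩
        sum (map weight (L ─ P∈L) ++ map weight (extensions P))
          ≡⟨ sum-++ (map weight (L ─ P∈L)) _ ⟩
        rest + sum (map weight (extensions P))
          <⟨ ℕ.+-monoʳ-< rest (weight-extensions P (extended-short inv minimal test)) ⟩
        rest + weight P                               ≡⟨ ℕ.+-comm rest (weight P) ⟩
        weight P + rest                               ≡⟨ measure-─ P∈L ⟨
        sum (map weight L)                            ∎
        where
        open ℕ.≤-Reasoning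
        rest = sum (map weight (L ─ P∈L))

      -- Excluded middle makes `_≤ᴿ_` total, so that a path of minimum key exists, and decides which
      -- of the three transitions it triggers.
      progress : ∀ P L UB → ∃ (⟨ P ∷ L , UB ⟩ ⟶_)
      progress P L UB with ∃-minimal ≤ᴿ-trans (≤ᴿ-total em) key P L
      ... | m , m∈ , minimal with em {P = Improves UB m} | em {P = LowerBoundTest UB m}
      ...   | yes improves | _         = _ , improve m∈ minimal improves
      ...   | no ¬improves | yes test  = _ , extend m∈ minimal ¬improves test
      ...   | no ¬improves | no  ¬test = _ , discard m∈ minimal ¬improves ¬test

      terminates : ∀ s → Invariant s → Acc ℕ._<_ (measure s) → Terminates s
      terminates ⟨ []    , UB ⟩ inv _         = stop
      terminates ⟨ P ∷ L , UB ⟩ inv (acc rec) = iterate (progress P L UB)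
        (λ step → terminates _ (invariant-⟶ step inv) (rec (measure-⟶ inv step)))

      terminates-correctly : Terminates initial × (∀ {UB} → initial ⟶* ⟨ [] , UB ⟩ → Correct UB)
      terminates-correctly = terminates initial invariant-initial (<-wellFounded _) ,
        λ run → Invariant⇒Correct (invariant-⟶* run invariant-initial)

-- Assembly of the three cases.

theorem1 : (∀ {ℓ} → ExcludedMiddle ℓ) →
    ∀ {c ℓ₁ ℓ₂} (M : LatticeOrderedMonoid c ℓ₁ ℓ₂) →
    let open LatticeOrderedMonoid M in
    ConditionallyComplete →
    (I : Problem M) →
    let open Problem I in
    (b : Vertex → Carrier) → LowerBounds b →
    let open GeneralizedA* I b in
    ( Acyclic
    ⊎ (AssumptionW × AssumptionB × (∀ a → 𝟎 < x a) × (∀ v → 𝟎 ≤ b v))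
    ⊎ (AssumptionW × AssumptionB × Commutative × PositiveCycles) ) →
    Terminates initial ×
    (∀ {UB} → initial ⟶* ⟨ [] , UB ⟩ → Correct UB)
theorem1 em M _ I b bounds = [ acyclic-case , [ positiveArcs-case , positiveCycles-case ]′ ]′
  where
  open LatticeOrderedMonoid M
  open LatticeOrderedMonoidProperties M
  open Problem I
  open ProblemProperties I
  open GeneralizedA* I b
  open GeneralizedA*Properties em I b bounds

  Goal : Set₁
  Goal = Terminates initial × (∀ {UB} → initial ⟶* ⟨ [] , UB ⟩ → Correct UB)

  acyclic-case : Acyclic → Goal
  acyclic-case acyclic =
    -- Without cycles `PositiveCycles` holds vacuously.
    terminates-correctly (positiveCycles⇒closedPath≥𝟎 (λ C → contradiction C acyclic)) ∣V∣
      (λ {_} {_} {_} {P} _ _ _ → Acyclic⇒length-bounded acyclic P)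

  positiveArcs-case : AssumptionW × AssumptionB × (∀ a → 𝟎 < x a) × (∀ v → 𝟎 ≤ b v) → Goal
  positiveArcs-case (W , B@(_ , _ , x_M , x_M<⋁ , _) , 0<x , 0≤b)
    with positiveArcs⇒length-bounded em W x_M<⋁ 0<x
  ... | N , bound = terminates-correctly (λ C → positiveArcs⇒path≥𝟎 0<x C) N
    λ {_} {_} {v} {P} inv minimal test →
      -- Being nonnegative, `b v` may be dropped from the bound by `x_M`.
      bound P (≤-trans (x≤x⊕y (0≤b v)) (extended≤x_M B P inv minimal test))

  positiveCycles-case : AssumptionW × AssumptionB × Commutative × PositiveCycles → Goal
  positiveCycles-case (W , B@(_ , _ , x_M , x_M<⋁ , _) , comm , 0<cycle)
    with positiveCycles⇒length-bounded em W x_M<⋁ comm 0<cycle o b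
  ... | N , bound = terminates-correctly (positiveCycles⇒closedPath≥𝟎 0<cycle) N
    -- Here `b v` need not be nonnegative; it stays a summand, absorbed in the common bound.
    λ {_} {_} {_} {P} inv minimal test → bound P (extended≤x_M B P inv minimal test)
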